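{- Let $\mathcal J$ be an ideal on $\omega$. (1) The following conditions are equivalent: (a) $\mathcal J$ is extendable to a selective ideal (i.e. $\mathcal J\subseteq\mathcal J'$ for some selective ideal $\mathcal J'$ on $\omega$); (b) $\mathcal{ED}\not\preceq^{\omega_1}_{\omega^\omega,1-1}\mathcal J$; (c) $\mathcal{ED}\not\preceq^{\omega_1}_{\omega^\omega,\mathrm{Fin}-1}\mathcal J$; (d) $\mathcal{ED}\not\preceq^{\omega_1}_{\omega^\omega,\omega^\omega}\mathcal J$. (2) Under CH, the conditions (a), (b), (c), (d) listed in (1) are equivalent to each of the following: (e) there is a selective ultrafilter which is not a $\mathcal J$-point; (f) there is a selective ultrafilter which is not a weak $\mathcal J$-ultrafilter; (g) there is a selective ultrafilter which is not a $\mathcal J$-ultrafilter.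
   Context: An ideal on a set $X$ is a family of subsets of $X$ closed under finite unions and subsets, containing all finite subsets of $X$ and not containing $X$; $\mathcal J^+=\mathcal P(X)\setminus\mathcal J$. Ideals on countably infinite sets are regarded as ideals on $\omega$ via fixed bijections. $\mathcal{ED}=\{A\subseteq\omega\times\omega:\exists m$ such that for all but finitely many $n$, $|\{k:(n,k)\in A\}|<m\}$. $\mathcal J$ is a selective ideal if for every decreasing sequence $(A_n)_{n\in\omega}$ of sets in $\mathcal J^+$ there is $A\in\mathcal J^+$, $A\subseteq A_0$, such that $|A\cap(A_n\setminus A_{n+1})|\le1$ for every $n$. For $\mathcal F\subseteq\omega^\omega$ and ideals $\mathcal I,\mathcal K$ on $\omega$, $\mathcal I\le_{\mathcal F}\mathcal K$ means that there is $f\in\mathcal F$ with $f^{ -1}[B]\in\mathcal K$ for every $B\in\mathcal I$. $\mathrm{Fin}-1$ and $1-1$ denote the families of all finite-to-one, respectively one-to-one, functions $\omega\to\omega$. For an ideal $\mathcal K$ on $\omega$ and $\mathcal A\subseteq\mathcal P(\omega)$, $\mathcal K(\mathcal A)=\{B\subseteq\omega:\exists F\in[\mathcal A]^{<\omega}\ (B\setminus\bigcup F\in\mathcal K)\}$. $\mathcal I\preceq^{\omega_1}_{\mathcal F,\mathcal G}\mathcal J$ means: for each ideal $\mathcal J'$ on $\omega$ with $\mathcal J\le_{\mathcal G}\mathcal J'$ there is a countable $\mathcal A\subseteq\mathcal P(\omega)$ with $\omega\notin\mathcal J'(\mathcal A)$ and $\mathcal I\le_{\mathcal F}\mathcal J'(\mathcal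 A)$. Ultrafilters on $\omega$ contain all cofinite sets; $\mathcal U^*=\{\omega\setminus A:A\in\mathcal U\}$. $\mathcal U$ is a selective (Ramsey) ultrafilter if $\mathcal U^*$ is a selective ideal. $\mathcal U$ is a $\mathcal J$-ultrafilter (weak $\mathcal J$-ultrafilter, $\mathcal J$-point) if $\mathcal J\not\le_{\mathcal F}\mathcal U^*$ for $\mathcal F=\omega^\omega$ ($\mathrm{Fin}-1$, $1-1$, respectively). -}

module Defs where

open import Data.List.Base using (List; length; foldr)
open import Data.List.Membership.Propositional using () renaming (_∈_ to _∈ₗ_)
open import Data.List.Relation.Unary.All using (All)
open import Data.Nat.Base using (ℕ; suc; _<_)
open import Data.Product.Base using (∃; ∃-syntax; _×_; _,_; proj₁)
open import Data.Sum.Base using (_⊎_)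
open import Function.Bundles using (_⤖_; Bijection)
open import Function.Definitions using (Injective)
open import Level using (Level; 0ℓ; _⊔_) renaming (suc to lsuc)
open import Relation.Binary.Bundles using (Setoid)
open import Relation.Binary.PropositionalEquality.Core using (_≡_)
import Relation.Binary.Construct.On as On
open import Relation.Nullary.Negation.Core using (¬_)
open import Relation.Unary
  using (Pred; _∈_; _∉_; _⊆_; _≐_; _∩_; _∪_; _∖_; ∁; ∅; U; _⊢_)
open import Relation.Unary.Relation.Binary.Equality using (≐-setoid)

-- Subsets are predicates, compared by extensional equality _≐_.  In the
-- presence of excluded middle every proposition is logically equivalent to
-- one in Set, so restricting subsets, and the families quantified over below,
-- to predicates valued in Set loses no generality.  Families derived from
-- others may land in Set₁, whence the level-polymorphic definitions.

𝒫 : Set → Set₁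
𝒫 X = Pred X 0ℓ

Family : (ℓ : Level) → Set → Set (lsuc 0ℓ ⊔ lsuc ℓ)
Family ℓ X = Pred (𝒫 X) ℓ

-- Cardinality bounds are witnessed by a list, possibly with repetitions or
-- extra elements, covering the set.

Finite : {X : Set} → 𝒫 X → Set
Finite {X} A = ∃[ xs ] (∀ {x : X} → x ∈ A → x ∈ₗ xs)

∣_∣<_ : {X : Set} → 𝒫 X → ℕ → Set
∣_∣<_ {X} A m = ∃[ xs ] (length xs < m × (∀ {x : X} → x ∈ A → x ∈ₗ xs))

∣_∣≤_ : {X : Set} → 𝒫 X → ℕ → Set
∣ A ∣≤ m = ∣ A ∣< suc m

-- "At most countable": contained, up to _≐_, in the range of a sequence.

Countable : {ℓ : Level} → Family ℓ ℕ → Set (lsuc 0ℓ ⊔ ℓ)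
Countable 𝒜 = ∃ λ (e : ℕ → 𝒫 ℕ) → ∀ {A} → A ∈ 𝒜 → ∃[ n ] A ≐ e n

_⁺ : {ℓ : Level} {X : Set} → Family ℓ X → Family ℓ X
𝒥 ⁺ = ∁ 𝒥

record IsIdeal {ℓ : Level} {X : Set} (𝒥 : Family ℓ X) : Set (lsuc 0ℓ ⊔ ℓ) where
  field
    ∪-closed : ∀ {A B} → A ∈ 𝒥 → B ∈ 𝒥 → (A ∪ B) ∈ 𝒥
    ⊆-closed : ∀ {A B} → A ⊆ B → B ∈ 𝒥 → A ∈ 𝒥
    finite   : ∀ {A} → Finite A → A ∈ 𝒥
    proper   : U ∉ 𝒥

record IsSelectiveIdeal {ℓ : Level} (𝒥 : Family ℓ ℕ) : Set (lsuc 0ℓ ⊔ ℓ) where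
  field
    isIdeal  : IsIdeal 𝒥
    selector : (A : ℕ → 𝒫 ℕ) → (∀ n → A n ∈ 𝒥 ⁺) → (∀ n → A (suc n) ⊆ A n) →
               ∃ λ (B : 𝒫 ℕ) → B ∈ 𝒥 ⁺ × B ⊆ A 0 ×
                 (∀ n → ∣ B ∩ (A n ∖ A (suc n)) ∣≤ 1)

𝓔𝓓 : Family 0ℓ (ℕ × ℕ)
𝓔𝓓 A = ∃[ m ] Finite (λ n → ¬ (∣ (λ k → A (n , k)) ∣< m))

-- A family on X regarded as a family on ℕ along a bijection.

transport : {ℓ : Level} {X : Set} → X ⤖ ℕ → Family ℓ X → Family ℓ ℕ
transport φ 𝒥 B = (Bijection.to φ ⊢ B) ∈ 𝒥

FunctionClass : Set₁
FunctionClass = Pred (ℕ → ℕ) 0ℓ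

All-functions Fin-1 1-1 : FunctionClass
All-functions = U
Fin-1 f       = ∀ n → Finite (λ k → f k ≡ n)
1-1 f         = Injective _≡_ _≡_ f

_≤[_]_ : {a b : Level} → Family a ℕ → FunctionClass → Family b ℕ →
         Set (lsuc 0ℓ ⊔ a ⊔ b)
𝓘 ≤[ 𝓕 ] 𝓚 = ∃ λ (f : ℕ → ℕ) → f ∈ 𝓕 × (∀ B → B ∈ 𝓘 → (f ⊢ B) ∈ 𝓚)

_⟨_⟩ : {a b : Level} → Family a ℕ → Family b ℕ → Family (lsuc 0ℓ ⊔ a ⊔ b) ℕ
(𝓚 ⟨ 𝒜 ⟩) B =
  ∃ λ (Fs : List (𝒫 ℕ)) → All (_∈ 𝒜) Fs × (B ∖ foldr _∪_ ∅ Fs) ∈ 𝓚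

_≼ω₁[_,_]_ : {a b : Level} → Family a ℕ → FunctionClass → FunctionClass →
             Family b ℕ → Set (lsuc 0ℓ ⊔ a ⊔ b)
𝓘 ≼ω₁[ 𝓕 , 𝓖 ] 𝒥 =
  (𝒥′ : Family 0ℓ ℕ) → IsIdeal 𝒥′ → 𝒥 ≤[ 𝓖 ] 𝒥′ →
  ∃ λ (𝒜 : Family 0ℓ ℕ) → Countable 𝒜 × U ∉ 𝒥′ ⟨ 𝒜 ⟩ × 𝓘 ≤[ 𝓕 ] (𝒥′ ⟨ 𝒜 ⟩)

ExtendableToSelective : Family 0ℓ ℕ → Set₁
ExtendableToSelective 𝒥 = ∃ λ (𝒥′ : Family 0ℓ ℕ) → IsSelectiveIdeal 𝒥′ × 𝒥 ⊆ 𝒥′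

record IsUltrafilter (𝒰 : Family 0ℓ ℕ) : Set₁ where
  field
    ∩-closed : ∀ {A B} → A ∈ 𝒰 → B ∈ 𝒰 → (A ∩ B) ∈ 𝒰
    ⊆-closed : ∀ {A B} → A ⊆ B → A ∈ 𝒰 → B ∈ 𝒰
    cofinite : ∀ {A} → Finite (∁ A) → A ∈ 𝒰
    proper   : ∅ ∉ 𝒰
    ultra    : ∀ A → A ∈ 𝒰 ⊎ ∁ A ∈ 𝒰

_* : Family 0ℓ ℕ → Family (lsuc 0ℓ) ℕ
(𝒰 *) B = ∃ λ (A : 𝒫 ℕ) → A ∈ 𝒰 × B ≐ ∁ A

IsSelectiveUltrafilter : Family 0ℓ ℕ → Set₁
IsSelectiveUltrafilter 𝒰 = IsUltrafilter 𝒰 × IsSelectiveIdeal (𝒰 *)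

_-Ultrafilter _-WeakUltrafilter _-Point : Family 0ℓ ℕ → Family 0ℓ ℕ → Set₁
(𝒥 -Ultrafilter) 𝒰     = ¬ (𝒥 ≤[ All-functions ] (𝒰 *))
(𝒥 -WeakUltrafilter) 𝒰 = ¬ (𝒥 ≤[ Fin-1 ] (𝒰 *))
(𝒥 -Point) 𝒰           = ¬ (𝒥 ≤[ 1-1 ] (𝒰 *))

-- A family of subsets of ℕ as a set of points of 𝒫 ℕ modulo _≐_.

∣_∣ₛ : Family 0ℓ ℕ → Setoid (lsuc 0ℓ) 0ℓ
∣ 𝓢 ∣ₛ = On.setoid {B = ∃ (_∈ 𝓢)} (≐-setoid ℕ 0ℓ) proj₁

-- The continuum hypothesis, as the absence of intermediate cardinalities:
-- every subset of the power set of ℕ is countable or has its full size.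

CH : Set₁
CH = (𝓢 : Family 0ℓ ℕ) → Countable 𝓢 ⊎ Bijection ∣ 𝓢 ∣ₛ (≐-setoid ℕ 0ℓ)

{-# OPTIONS --safe #-}
module Submission where

-- Reducing ED to a countably generated extension of an ideal is exactly what
-- selectivity forbids.  Let 𝒥′ be an ideal.
--
-- If 𝒥′ is selective and 𝒜 is countable with ω outside 𝒥′(𝒜), the complements
-- of the members of 𝒜 have a positive pseudo-intersection P, and 𝒥′(𝒜) leaves
-- only sets of 𝒥′ as traces on P (absorb).  Given f, the sets of those x whose
-- image lies in row n or higher decrease; selectivity (settle) yields a positive
-- Y inside P that either maps into finitely many rows or has at most one point
-- over each row.  Both ways the image of Y is in ED, so f does not reduce ED to
-- 𝒥′(𝒜) (selective⇒ED≰).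
--
-- Conversely, if no such 𝒜 admits a reduction of ED, then 𝒥′ itself is selective
-- (ED≰⇒selective): for a decreasing positive sequence A, take the complements
-- of the A n as 𝒜 and send a point of A n outside A (n + 1) into row n,
-- injectively.  The preimage of a set in ED consists, apart from finitely many
-- rows, of boundedly many sets with at most one point in each difference of
-- successive terms; if it is outside 𝒥′(𝒜), one of these sets is positive.
--
-- Finally, {B : the preimage of B under f is in 𝓚} is selective whenever 𝓚 is,
-- so an ideal with some selective ideal above it, under any kind of reduction,
-- extends to a selective ideal (selective-above⇒extendable).  Hence every class
-- of reductions that admits the identity gives the same condition.
--
-- For the ultrafilters, CH lists all sequences of subsets of ω along a
-- well-ordering in such a way that every sequence occurs at a stage with only
-- countably many predecessors (CH⇒schedule).  Recursion along such stages
-- builds an almost decreasing tower of sets positive for a given selective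
-- ideal 𝒥′: take a pseudo-intersection of the earlier sets, then shrink it so
-- that it is disjoint from some term of the current sequence or has at most one
-- point in each difference of its terms.  Constant sequences make the tower generate an ultrafilter whose
-- dual contains 𝒥′; decreasing sequences make that ultrafilter selective.

open import Axiom.ExcludedMiddle using (ExcludedMiddle)
open import Axiom.Extensionality.Propositional using (Extensionality)
open import Data.Bool.Base using (Bool; not; T)
open import Data.Bool.Properties using (T?; not-¬)
open import Data.Empty using (⊥; ⊥-elim)
open import Data.List.Base using (List; []; _∷_; _++_; length; foldr; map; drop; upTo)
open import Data.List.Membership.Propositional using () renaming (_∈_ to _∈ₗ_)
open import Data.List.Membership.Propositional.Properties using (∈-++⁺ˡ; ∈-++⁺ʳ; ∈-map⁺; ∈-upTo⁺)
open import Data.List.Properties using (length-map)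
open import Data.List.Relation.Unary.All using (All; []; _∷_)
open import Data.List.Relation.Unary.Any using (here; there)
open import Data.Nat.Base using (ℕ; zero; suc; _<_; _≤_; z≤n; s≤s; _⊔_)
open import Data.Nat.Properties using (≤-refl; ≤-trans; <-irrefl; <-cmp; <⇒≤; ≰⇒>; m≤m⊔n; m≤n⊔m)
open import Data.Product.Base using (∃; _×_; _,_; proj₁; proj₂; map₂)
open import Data.Sum.Base as Sum using (_⊎_; inj₁; inj₂; [_,_]′)
open import Data.Unit.Base using (tt)
open import Function.Base using (id; case_of_)
open import Function.Bundles using (_⇔_; _⤖_; mk⇔; Bijection)
open import Induction.WellFounded as WF using (WellFounded; Acc; acc; module FixPoint)
open import Level using (Level; 0ℓ) renaming (suc to lsuc)
open import Relation.Binary.Core using (Rel)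
open import Relation.Binary.Definitions using (tri<; tri≈; tri>; Transitive)
open import Relation.Binary.PropositionalEquality.Core using (_≡_; _≢_; refl; sym; trans; cong; subst)
open import Relation.Nullary.Decidable.Core using (yes; no; does; True; toWitness; fromWitness; decidable-stable)
open import Relation.Nullary.Decidable using (does-⇔)
open import Relation.Nullary.Negation.Core using (¬_)
open import Relation.Unary.Relation.Binary.Equality using (≐-setoid)
open import Relation.Unary using (_∈_; _∉_; _⊆_; _≐_; _∩_; _∪_; _∖_; ∁; ∅; U; _⊢_)
open import Defs

-- Finite sets

Finite-⊆ : {X : Set} (A B : 𝒫 X) → A ⊆ B → Finite B → Finite A
Finite-⊆ A B A⊆B (xs , cover) = xs , λ x∈A → cover (A⊆B x∈A)

Finite-∪ : {X : Set} (A B : 𝒫 X) → Finite A → Finite B → Finite (A ∪ B)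
Finite-∪ A B (xs , p) (ys , q) =
  (xs ++ ys) , [ (λ x∈A → ∈-++⁺ˡ (p x∈A)) , (λ x∈B → ∈-++⁺ʳ xs (q x∈B)) ]′

≤1-unique : {X : Set} (A : 𝒫 X) → ∣ A ∣≤ 1 → ∀ {x y} → x ∈ A → y ∈ A → x ≡ y
≤1-unique A ([] , _ , cover) x∈A _ = case cover x∈A of λ ()
≤1-unique A (z ∷ [] , _ , cover) x∈A y∈A with cover x∈A | cover y∈A
... | here x≡z | here y≡z = trans x≡z (sym y≡z)
≤1-unique A (_ ∷ _ ∷ _ , s≤s (s≤s ()) , _) _ _

∣∣<-⊆ : {X : Set} {m : ℕ} (A B : 𝒫 X) → A ⊆ B → ∣ B ∣< m → ∣ A ∣< m
∣∣<-⊆ A B A⊆B (xs , small , cover) = xs , small , λ x∈A → cover (A⊆B x∈A)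

_⊆*_ : {X : Set} → 𝒫 X → 𝒫 X → Set
A ⊆* B = Finite (A ∖ B)

⊆⇒⊆* : {X : Set} (A B : 𝒫 X) → A ⊆ B → A ⊆* B
⊆⇒⊆* A B A⊆B = [] , λ (x∈A , x∉B) → ⊥-elim (x∉B (A⊆B x∈A))

-- Sequences of sets

Decreasing : (ℕ → 𝒫 ℕ) → Set
Decreasing A = ∀ n → A (suc n) ⊆ A n

decreasing-≤ : (A : ℕ → 𝒫 ℕ) → Decreasing A → ∀ {m n} → m ≤ n → A n ⊆ A m
decreasing-≤ A dec {zero}  {zero}  _ = id
decreasing-≤ A dec {zero}  {suc n} _ = λ x∈ → decreasing-≤ A dec {0} {n} z≤n (dec n x∈)
decreasing-≤ A dec {suc m} {suc n} (s≤s m≤n) =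
  decreasing-≤ (λ k → A (suc k)) (λ k → dec (suc k)) m≤n

meet : (ℕ → 𝒫 ℕ) → ℕ → 𝒫 ℕ
meet Z zero    = U
meet Z (suc n) = meet Z n ∩ Z n

Transversal : 𝒫 ℕ → (ℕ → 𝒫 ℕ) → Set
Transversal Y A = Y ⊆ A 0 × (∀ n → ∣ Y ∩ (A n ∖ A (suc n)) ∣≤ 1)

-- What one stage of the construction has to achieve for the sequence A.  For a
-- constant sequence this decides the set it repeats: Y lies inside the
-- complement of the set or inside the set.
Settles : 𝒫 ℕ → (ℕ → 𝒫 ℕ) → Set
Settles Y A = (∃ λ n → Y ⊆ ∁ (A n)) ⊎ Transversal Y A

Settles-≐ : (Y : 𝒫 ℕ) (A B : ℕ → 𝒫 ℕ) → (∀ n → A n ≐ B n) → Settles Y A → Settles Y B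
Settles-≐ Y A B A≐B (inj₁ (n , Y∥A)) = inj₁ (n , λ y∈Y y∈B → Y∥A y∈Y (proj₂ (A≐B n) y∈B))
Settles-≐ Y A B A≐B (inj₂ (Y⊆A , few)) = inj₂
  ( (λ y∈Y → proj₁ (A≐B 0) (Y⊆A y∈Y))
  , λ n → ∣∣<-⊆ (Y ∩ (B n ∖ B (suc n))) (Y ∩ (A n ∖ A (suc n)))
      (λ (y∈Y , y∈Bn , y∉B) → y∈Y , proj₂ (A≐B n) y∈Bn , λ y∈A → y∉B (proj₁ (A≐B (suc n)) y∈A))
      (few n) )

-- Well-orders and schedules

-- The stages of an exhaustion of a set by repeatedly adding one new element.
-- Unions indexed by X itself suffice, since a subset of X is the union of a
-- family that has one member for each of its points; this keeps the type small.
data Code (X : Set) : Set where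
  start : Code X
  next  : Code X → Code X
  ⋃     : (X → Code X) → Code X

Enumerable : {X : Set} → 𝒫 X → Set
Enumerable {X} P = ∃ λ (e : ℕ → X) → ∀ {x} → x ∈ P → ∃ λ n → e n ≡ x

Cantor : Set
Cantor = ℕ → Bool

Cantor-uncountable : ¬ Enumerable {Cantor} U
Cantor-uncountable (e , covers) with covers {x = λ n → not (e n n)} tt
... | n , en≡ = not-¬ refl (cong (λ b → b n) en≡)

record WellOrder (X : Set) : Set₁ where
  field
    _≺_      : Rel X 0ℓ
    ≺-wf     : WellFounded _≺_
    ≺-trans  : Transitive _≺_
    ≺-connex : ∀ x y → x ≢ y → x ≺ y ⊎ y ≺ x

  Early : 𝒫 X
  Early x = Enumerable (_≺ x)

-- A transfinite list of sequences of sets.  Every sequence has to occur at an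
-- early stage, because it is there that the predecessors, being countably many,
-- admit a pseudo-intersection.
record Schedule : Set₁ where
  field
    Stage     : Set
    wellOrder : WellOrder Stage
    task      : Stage → ℕ → 𝒫 ℕ
  open WellOrder wellOrder public

  field
    scheduled : ∀ (A : ℕ → 𝒫 ℕ) → ∃ λ x → x ∈ Early × (∀ n → task x n ≐ A n)

module Classical
  (lem : ∀ {ℓ} → ExcludedMiddle ℓ)
  (ext : ∀ {a b} → Extensionality a b)
  where

  ¬¬-elim : ∀ {ℓ} {P : Set ℓ} → ¬ ¬ P → P
  ¬¬-elim = decidable-stable lem

  ¬∀⇒∃¬ : ∀ {a b} {X : Set a} {P : X → Set b} → ¬ (∀ x → P x) → ∃ λ x → ¬ P x
  ¬∀⇒∃¬ ¬∀ = ¬¬-elim λ ¬∃ → ¬∀ λ x → ¬¬-elim λ ¬Px → ¬∃ (x , ¬Px)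

  ⊆-∖-∪ : {X : Set} (A B : 𝒫 X) → A ⊆ (A ∖ B) ∪ B
  ⊆-∖-∪ A B {x} x∈A with lem {P = x ∈ B}
  ... | yes x∈B = inj₂ x∈B
  ... | no x∉B = inj₁ (x∈A , x∉B)

  ⊆*-trans : {X : Set} (A B C : 𝒫 X) → A ⊆* B → B ⊆* C → A ⊆* C
  ⊆*-trans A B C A⊆B B⊆C =
    Finite-⊆ (A ∖ C) ((A ∖ B) ∪ (B ∖ C))
      (λ (x∈A , x∉C) → Sum.map₂ (_, x∉C) (⊆-∖-∪ A B x∈A))
      (Finite-∪ (A ∖ B) (B ∖ C) A⊆B B⊆C)

  ⊆*-∩ : {X : Set} (A B C : 𝒫 X) → A ⊆* B → A ⊆* C → A ⊆* (B ∩ C)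
  ⊆*-∩ A B C A⊆B A⊆C =
    Finite-⊆ (A ∖ (B ∩ C)) ((A ∖ B) ∪ (A ∖ C))
      (λ (x∈A , x∉B∩C) → case ⊆-∖-∪ A B x∈A of λ where
        (inj₁ x∈A∖B) → inj₁ x∈A∖B
        (inj₂ x∈B)   → inj₂ (x∈A , λ x∈C → x∉B∩C (x∈B , x∈C)))
      (Finite-∪ (A ∖ B) (A ∖ C) A⊆B A⊆C)

  -- Ideals

  module Ideal {ℓ : Level} {𝒥 : Family ℓ ℕ} (ideal : IsIdeal 𝒥) where
    open IsIdeal ideal public

    ⊆*-closed : ∀ {A B} → A ⊆* B → B ∈ 𝒥 → A ∈ 𝒥
    ⊆*-closed {A} {B} A⊆B B∈𝒥 = ⊆-closed (⊆-∖-∪ A B) (∪-closed (finite A⊆B) B∈𝒥)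

    -- In a chain under almost inclusion, a finite intersection almost contains
    -- one of the sets intersected.
    meet-chain : (Z : ℕ → 𝒫 ℕ) → (∀ m n → Z m ⊆* Z n ⊎ Z n ⊆* Z m) →
                 (∀ n → Z n ∈ 𝒥 ⁺) → ∀ n → meet Z n ∈ 𝒥 ⁺
    meet-chain Z comparable positive n meet∈𝒥 =
      positive (proj₁ (below n)) (⊆*-closed (proj₂ (below n)) meet∈𝒥)
      where
      below : ∀ n → ∃ λ k → Z k ⊆* meet Z n
      below zero = 0 , ⊆⇒⊆* (Z 0) U _
      below (suc n) with below n
      ... | k , Zk⊆ with comparable k n
      ...   | inj₁ Zk⊆Zn = k , ⊆*-∩ (Z k) (meet Z n) (Z n) Zk⊆ Zk⊆Zn
      ...   | inj₂ Zn⊆Zk = n , ⊆*-∩ (Z n) (meet Z n) (Z n)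
                (⊆*-trans (Z n) (Z k) (meet Z n) Zn⊆Zk Zk⊆) (⊆⇒⊆* (Z n) (Z n) id)

  -- Selective ideals

  module Selective {ℓ : Level} {𝒥 : Family ℓ ℕ} (selective : IsSelectiveIdeal 𝒥) where
    open IsSelectiveIdeal selective public
    open Ideal isIdeal public

    -- A selector of the partial intersections loses at most one point each time
    -- the intersection shrinks, hence finitely many before any given stage.
    pseudo-intersection : (Z : ℕ → 𝒫 ℕ) → (∀ n → meet Z n ∈ 𝒥 ⁺) →
                          ∃ λ P → P ∈ 𝒥 ⁺ × (∀ n → P ⊆* Z n)
    pseudo-intersection Z positive with selector (meet Z) positive (λ n → proj₁)
    ... | P , P∈⁺ , _ , few = P , P∈⁺ , almost
      where
      almost-meet : ∀ n → P ⊆* meet Z n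
      almost-meet zero    = ⊆⇒⊆* P U _
      almost-meet (suc n) =
        Finite-⊆ (P ∖ meet Z (suc n)) ((P ∖ meet Z n) ∪ (P ∩ (meet Z n ∖ meet Z (suc n))))
          (λ (x∈P , x∉) → Sum.map₂ (λ x∈ → x∈P , x∈ , x∉) (⊆-∖-∪ P (meet Z n) x∈P))
          (Finite-∪ (P ∖ meet Z n) (P ∩ (meet Z n ∖ meet Z (suc n))) (almost-meet n)
            (proj₁ (few n) , proj₂ (proj₂ (few n))))
      almost : ∀ n → P ⊆* Z n
      almost n = Finite-⊆ (P ∖ Z n) (P ∖ meet Z (suc n))
        (λ (x∈P , x∉Z) → x∈P , λ x∈ → x∉Z (proj₂ x∈)) (almost-meet (suc n))

    -- Either P is positive on every A n, and then the traces of A on P have a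
    -- selector, or removing some A n costs P only a set in the ideal.
    settle : (A : ℕ → 𝒫 ℕ) → Decreasing A → ∀ P → P ∈ 𝒥 ⁺ →
             ∃ λ Y → Y ∈ 𝒥 ⁺ × Y ⊆ P × Settles Y A
    settle A dec P P∈⁺ with lem {P = ∃ λ n → (P ∩ A n) ∈ 𝒥}
    ... | yes (n , P∩An∈𝒥) = (P ∖ A n) , positive , proj₁ , inj₁ (n , proj₂)
      where
      positive : (P ∖ A n) ∈ 𝒥 ⁺
      positive P∖An∈𝒥 = P∈⁺ (⊆-closed
        (λ x∈P → Sum.map₂ (x∈P ,_) (⊆-∖-∪ P (A n) x∈P)) (∪-closed P∖An∈𝒥 P∩An∈𝒥))
    ... | no none with selector (λ n → P ∩ A n) (λ n p → none (n , p))
                         (λ n (x∈P , x∈A) → x∈P , dec n x∈A)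
    ...   | Y , Y∈⁺ , Y⊆P∩A , few = Y , Y∈⁺ , (λ y∈Y → proj₁ (Y⊆P∩A y∈Y)) , inj₂
          ( (λ y∈Y → proj₂ (Y⊆P∩A y∈Y))
          , λ n → ∣∣<-⊆ (Y ∩ (A n ∖ A (suc n))) (Y ∩ ((P ∩ A n) ∖ (P ∩ A (suc n))))
              (λ (y∈Y , y∈A , y∉A) →
                y∈Y , (proj₁ (Y⊆P∩A y∈Y) , y∈A) , λ y∈P∩A → y∉A (proj₂ y∈P∩A))
              (few n) )

  -- Images of selective ideals

  -- The ideal of sets with preimage in 𝓚 extends 𝒥, and is selective because the
  -- image of a selector for the preimages of a sequence selects from that
  -- sequence.  Membership is resized by excluded middle, as 𝓚 may be large.
  selective-above⇒extendable : {ℓ : Level} (𝒥 : Family 0ℓ ℕ) → IsIdeal 𝒥 →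
                  {𝓚 : Family ℓ ℕ} → IsSelectiveIdeal 𝓚 →
                  𝒥 ≤[ All-functions ] 𝓚 → ExtendableToSelective 𝒥
  selective-above⇒extendable {ℓ} 𝒥 ideal {𝓚} selective (f , _ , pull) =
    𝒥′ , record { isIdeal = isIdeal′ ; selector = selector′ } , λ {B} B∈𝒥 → fromWitness (pull B B∈𝒥)
    where
    open Selective selective
    𝒥′ : Family 0ℓ ℕ
    𝒥′ B = True (lem {P = (f ⊢ B) ∈ 𝓚})
    isIdeal′ : IsIdeal 𝒥′
    isIdeal′ = record
      { ∪-closed = λ A∈ B∈ → fromWitness (⊆-closed id (∪-closed (toWitness A∈) (toWitness B∈)))
      ; ⊆-closed = λ A⊆B B∈ → fromWitness (⊆-closed (λ x∈ → A⊆B x∈) (toWitness B∈))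
      ; finite   = λ {A} A-fin → fromWitness (pull A (IsIdeal.finite ideal A-fin))
      ; proper   = λ U∈ → proper (⊆-closed id (toWitness U∈))
      }
    selector′ : (A : ℕ → 𝒫 ℕ) → (∀ n → A n ∈ 𝒥′ ⁺) → Decreasing A →
                ∃ λ B → B ∈ 𝒥′ ⁺ × Transversal B A
    selector′ A positive dec
      with selector (λ n → f ⊢ A n) (λ n p → positive n (fromWitness p)) (λ n → dec n)
    ... | B , B∈⁺ , B⊆ , few = f[B] , f[B]∈⁺ , f[B]⊆ , few′
      where
      f[B] : 𝒫 ℕ
      f[B] y = ∃ λ x → x ∈ B × f x ≡ y
      f[B]∈⁺ : f[B] ∈ 𝒥′ ⁺
      f[B]∈⁺ f[B]∈ = B∈⁺ (⊆-closed (λ {x} x∈B → x , x∈B , refl) (toWitness f[B]∈))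
      f[B]⊆ : f[B] ⊆ A 0
      f[B]⊆ (x , x∈B , refl) = B⊆ x∈B
      few′ : ∀ n → ∣ f[B] ∩ (A n ∖ A (suc n)) ∣≤ 1
      few′ n with few n
      ... | xs , small , cover =
        map f xs , subst (_< 2) (sym (length-map f xs)) small ,
        λ { ((x , x∈B , refl) , y∈A , y∉A) → ∈-map⁺ f (cover (x∈B , y∈A , y∉A)) }

  -- Selectivity and reductions of ED

  module Reduction (φ : (ℕ × ℕ) ⤖ ℕ) where
    open Bijection φ using (to; injective; surjective)

    from : ℕ → ℕ × ℕ
    from y = proj₁ (surjective y)

    from-to : ∀ p → from (to p) ≡ p
    from-to p = injective (proj₂ (surjective (to p)) refl)

    row col : ℕ → ℕ
    row y = proj₁ (from y)
    col y = proj₂ (from y)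

    row-to : ∀ n k → row (to (n , k)) ≡ n
    row-to n k = cong proj₁ (from-to (n , k))

    col-to : ∀ n k → col (to (n , k)) ≡ k
    col-to n k = cong proj₂ (from-to (n , k))

    ED : Family 0ℓ ℕ
    ED = transport φ 𝓔𝓓

    rows-below∈ED : ∀ n → (λ p → row p < n) ∈ ED
    rows-below∈ED n = 1 , upTo n , below
      where
      below : ∀ {i} → ¬ (∣ (λ k → row (to (i , k)) < n) ∣< 1) → i ∈ₗ upTo n
      below {i} large = ∈-upTo⁺ (¬¬-elim λ i≮n → large
        ([] , s≤s z≤n , λ {k} r<n → ⊥-elim (i≮n (subst (_< n) (row-to i k) r<n))))

    module _ {𝒥 : Family 0ℓ ℕ} (selective : IsSelectiveIdeal 𝒥) where
      open Selective selective

      -- A countably generated extension of a selective ideal is contained in the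
      -- restriction of that ideal to a single positive set: a pseudo-intersection
      -- of the complements of the generators.
      absorb : (𝒜 : Family 0ℓ ℕ) → Countable 𝒜 → U ∉ 𝒥 ⟨ 𝒜 ⟩ →
               ∃ λ P → P ∈ 𝒥 ⁺ × (∀ B → B ∈ 𝒥 ⟨ 𝒜 ⟩ → (P ∩ B) ∈ 𝒥)
      absorb 𝒜 (e , covers) U∉ with pseudo-intersection Z positive
        where
        -- The covering sequence may leave 𝒜; the terms that do are not to
        -- constrain the pseudo-intersection.
        Z : ℕ → 𝒫 ℕ
        Z n with lem {P = ∃ λ A → A ∈ 𝒜 × A ≐ e n}
        ... | yes (A , _) = ∁ A
        ... | no _ = U
        meet-large : ∀ n → ∃ λ Fs → All (_∈ 𝒜) Fs × ∁ (foldr _∪_ ∅ Fs) ⊆ meet Z n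
        meet-large zero = [] , [] , _
        meet-large (suc n) with meet-large n | lem {P = ∃ λ A → A ∈ 𝒜 × A ≐ e n}
        ... | Fs , Fs⊆𝒜 , large | yes (A , A∈𝒜 , _) =
              A ∷ Fs , A∈𝒜 ∷ Fs⊆𝒜 , λ x∉ → large (λ x∈Fs → x∉ (inj₂ x∈Fs)) , λ x∈A → x∉ (inj₁ x∈A)
        ... | Fs , Fs⊆𝒜 , large | no _ = Fs , Fs⊆𝒜 , λ x∉ → large x∉ , _
        positive : ∀ n → meet Z n ∈ 𝒥 ⁺
        positive n meet∈𝒥 with meet-large n
        ... | Fs , Fs⊆𝒜 , large = U∉ (Fs , Fs⊆𝒜 , ⊆-closed (λ x∈ → large (proj₂ x∈)) meet∈𝒥)
      ... | P , P∈⁺ , P⊆*Z = P , P∈⁺ , trace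
        where
        misses : ∀ {F} → F ∈ 𝒜 → Finite (P ∩ F)
        misses {F} F∈𝒜 with covers F∈𝒜
        ... | n , F≐en with P⊆*Z n
        ...   | P⊆*Zn with lem {P = ∃ λ A → A ∈ 𝒜 × A ≐ e n}
        ...     | yes (A , _ , A≐en) = Finite-⊆ (P ∩ F) (P ∖ ∁ A)
                    (λ (x∈P , x∈F) → x∈P , λ x∉A → x∉A (proj₂ A≐en (proj₁ F≐en x∈F))) P⊆*Zn
        ...     | no none = ⊥-elim (none (F , F∈𝒜 , F≐en))
        misses-all : ∀ {Fs} → All (_∈ 𝒜) Fs → (P ∩ foldr _∪_ ∅ Fs) ∈ 𝒥
        misses-all [] = finite ([] , λ ())
        misses-all (F∈𝒜 ∷ Fs⊆𝒜) = ⊆-closed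
          (λ (x∈P , x∈) → Sum.map (x∈P ,_) (x∈P ,_) x∈)
          (∪-closed (finite (misses F∈𝒜)) (misses-all Fs⊆𝒜))
        trace : ∀ B → B ∈ 𝒥 ⟨ 𝒜 ⟩ → (P ∩ B) ∈ 𝒥
        trace B (Fs , Fs⊆𝒜 , B∖Fs∈𝒥) = ⊆-closed
          (λ (x∈P , x∈B) → Sum.map₂ (x∈P ,_) (⊆-∖-∪ B (foldr _∪_ ∅ Fs) x∈B))
          (∪-closed B∖Fs∈𝒥 (misses-all Fs⊆𝒜))

      -- Settling the sets of points over high rows leaves a positive set whose
      -- image is covered by finitely many rows or is the graph of a partial
      -- function.  Its preimage contains it, yet has a trace in the ideal on P.
      selective⇒ED≰ : (𝒜 : Family 0ℓ ℕ) → Countable 𝒜 → U ∉ 𝒥 ⟨ 𝒜 ⟩ →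
                      ¬ (ED ≤[ All-functions ] (𝒥 ⟨ 𝒜 ⟩))
      selective⇒ED≰ 𝒜 countable U∉ (f , _ , pull) with absorb 𝒜 countable U∉
      ... | P , P∈⁺ , trace with settle (λ n x → n ≤ row (f x)) (λ n → <⇒≤) P P∈⁺
      ...   | Y , Y∈⁺ , Y⊆P , inj₁ (n , Y∥) = Y∈⁺ (⊆-closed
                (λ y∈Y → Y⊆P y∈Y , ≰⇒> (Y∥ y∈Y))
                (trace _ (pull (λ p → row p < n) (rows-below∈ED n))))
      ...   | Y , Y∈⁺ , Y⊆P , inj₂ (_ , few) = Y∈⁺ (⊆-closed
                (λ {y} y∈Y → Y⊆P y∈Y , y , y∈Y , refl)
                (trace _ (pull f[Y] f[Y]∈ED)))
        where
        f[Y] : 𝒫 ℕ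
        f[Y] p = ∃ λ y → y ∈ Y × f y ≡ p
        section : ∀ n → ∣ (λ k → to (n , k) ∈ f[Y]) ∣< 2
        section n with few n
        ... | xs , small , cover =
          map (λ x → col (f x)) xs , subst (_< 2) (sym (length-map _ xs)) small ,
          λ {k} (y , y∈Y , fy≡) →
            subst (_∈ₗ map (λ x → col (f x)) xs) (trans (cong col fy≡) (col-to n k))
              (∈-map⁺ (λ x → col (f x)) (cover (y∈Y , on-row k (trans (cong row fy≡) (row-to n k)))))
          where
          on-row : ∀ k {r} → r ≡ n → n ≤ r × ¬ (suc n ≤ r)
          on-row k refl = ≤-refl , <-irrefl refl
        f[Y]∈ED : f[Y] ∈ ED
        f[Y]∈ED = 2 , [] , λ {n} large → ⊥-elim (large (section n))

    module _ {𝒥 : Family 0ℓ ℕ} (ideal : IsIdeal 𝒥) where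
      open Ideal ideal

      -- If lists of bounded length cover the layers of lev, the covered set is a
      -- finite union of partial selectors: heads of the lists, heads of their
      -- tails, and so on.
      selections-small : (lev : ℕ → ℕ) (H : 𝒫 ℕ) →
        (∀ (g : ℕ → ℕ) → (λ k → k ∈ H × g (lev k) ≡ k) ∈ 𝒥) →
        ∀ m (L : ℕ → List ℕ) → (∀ n → length (L n) ≤ m) →
        (λ k → k ∈ H × k ∈ₗ L (lev k)) ∈ 𝒥
      selections-small lev H small zero L short =
        finite ([] , λ {k} (_ , k∈L) → ⊥-elim (empty (L (lev k)) (short (lev k)) k∈L))
        where
        empty : ∀ {k} (xs : List ℕ) → length xs ≤ 0 → ¬ (k ∈ₗ xs)
        empty [] _ ()
      selections-small lev H small (suc m) L short = ⊆-closed
        (λ {k} (k∈H , k∈L) → Sum.map (k∈H ,_) (k∈H ,_) (split (L (lev k)) k∈L))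
        (∪-closed (small (λ n → head (L n)))
          (selections-small lev H small m (λ n → drop 1 (L n)) (λ n → shorter (L n) (short n))))
        where
        head : List ℕ → ℕ
        head [] = 0
        head (x ∷ _) = x
        split : ∀ {k} (xs : List ℕ) → k ∈ₗ xs → head xs ≡ k ⊎ k ∈ₗ drop 1 xs
        split (_ ∷ _) (here k≡x) = inj₁ (sym k≡x)
        split (_ ∷ _) (there k∈) = inj₂ k∈
        shorter : ∀ (xs : List ℕ) → length xs ≤ suc m → length (drop 1 xs) ≤ m
        shorter [] _ = z≤n
        shorter (_ ∷ _) (s≤s p) = p

      -- The layers of A are the differences of its successive terms.  The
      -- hypothesis is applied to the map k ↦ (lev k , k), where lev k is the index
      -- of the layer containing k.  A set B in ED with preimage outside 𝒥 ⟨ 𝒜 ⟩ has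
      -- a preimage positive on every A n, and beyond the exceptional rows of B
      -- that preimage splits into boundedly many transversals of A.
      ED≰⇒selective :
        ((𝒜 : Family 0ℓ ℕ) → Countable 𝒜 → U ∉ 𝒥 ⟨ 𝒜 ⟩ → ¬ (ED ≤[ All-functions ] (𝒥 ⟨ 𝒜 ⟩))) →
        IsSelectiveIdeal 𝒥
      ED≰⇒selective unreduced = record { isIdeal = ideal ; selector = selector }
        where
        selector : (A : ℕ → 𝒫 ℕ) → (∀ n → A n ∈ 𝒥 ⁺) → Decreasing A →
                   ∃ λ Y → Y ∈ 𝒥 ⁺ × Transversal Y A
        selector A positive dec = Y , Y∈⁺ , (λ (k∈ , _) → decreasing-≤ A dec z≤n (proj₁ k∈)) ,
            λ n → (g n ∷ []) , s≤s (s≤s z≤n) , λ ((_ , gk) , k∈A , k∉A) →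
              here (trans (sym gk) (cong g (lev-unique k∈A k∉A)))
          where
          𝒜 : Family 0ℓ ℕ
          𝒜 B = ∃ λ n → B ≐ ∁ (A n)

          avoids : ∀ {Fs} → All (_∈ 𝒜) Fs → ∃ λ N → A N ⊆ ∁ (foldr _∪_ ∅ Fs)
          avoids [] = 0 , λ _ ()
          avoids ((n , F≐) ∷ Fs⊆𝒜) with avoids Fs⊆𝒜
          ... | N , AN⊆ = n ⊔ N , λ x∈A →
            [ (λ x∈F → proj₁ F≐ x∈F (decreasing-≤ A dec (m≤m⊔n n N) x∈A))
            , AN⊆ (decreasing-≤ A dec (m≤n⊔m n N) x∈A) ]′

          U∉ : U ∉ 𝒥 ⟨ 𝒜 ⟩
          U∉ (Fs , Fs⊆𝒜 , rest∈𝒥) with avoids Fs⊆𝒜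
          ... | N , AN⊆ = positive N (⊆-closed (λ x∈A → _ , AN⊆ x∈A) rest∈𝒥)

          -- Points in no layer are sent to pairwise different rows, so that any
          -- finite set of rows receives only finitely many of them.
          lev : ℕ → ℕ
          lev k with lem {P = ∃ λ n → k ∈ A n × k ∉ A (suc n)}
          ... | yes (n , _) = n
          ... | no _ = k

          lev-unique : ∀ {k n} → k ∈ A n → k ∉ A (suc n) → lev k ≡ n
          lev-unique {k} {n} k∈A k∉A with lem {P = ∃ λ n → k ∈ A n × k ∉ A (suc n)}
          ... | no none = ⊥-elim (none (n , k∈A , k∉A))
          ... | yes (m , k∈Am , k∉Am) with <-cmp m n
          ...   | tri< m<n _ _ = ⊥-elim (k∉Am (decreasing-≤ A dec m<n k∈A))
          ...   | tri≈ _ m≡n _ = m≡n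
          ...   | tri> _ _ n<m = ⊥-elim (k∉A (decreasing-≤ A dec n<m k∈Am))

          lev-high : ∀ {k N} → k ∈ A N → lev k < N → lev k ≡ k
          lev-high {k} k∈AN lev<N with lem {P = ∃ λ n → k ∈ A n × k ∉ A (suc n)}
          ... | yes (n , _ , k∉A) = ⊥-elim (k∉A (decreasing-≤ A dec lev<N k∈AN))
          ... | no _ = refl

          unreduced-at : ∃ λ B → ¬ (B ∈ ED → ((λ k → to (lev k , k)) ⊢ B) ∈ 𝒥 ⟨ 𝒜 ⟩)
          unreduced-at = ¬∀⇒∃¬ λ pull →
            unreduced 𝒜 ((λ n → ∁ (A n)) , id) U∉ ((λ k → to (lev k , k)) , _ , pull)

          B H : 𝒫 ℕ
          B = proj₁ unreduced-at
          H k = to (lev k , k) ∈ B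

          B∈ED : B ∈ ED
          B∈ED = ¬¬-elim λ B∉ → proj₂ unreduced-at λ B∈ → ⊥-elim (B∉ B∈)

          H∩A : ∀ N → (H ∩ A N) ∈ 𝒥 ⁺
          H∩A N H∩A∈𝒥 = proj₂ unreduced-at λ _ →
            (∁ (A N) ∷ []) , (N , id , id) ∷ [] ,
            ⊆-closed (λ (k∈H , k∉) → k∈H , ¬¬-elim λ k∉A → k∉ (inj₁ k∉A)) H∩A∈𝒥

          m : ℕ
          m = proj₁ B∈ED

          exceptions : List ℕ
          exceptions = proj₁ (proj₂ B∈ED)

          bound : (xs : List ℕ) → ∃ λ N → ∀ {n} → n ∈ₗ xs → n < N
          bound [] = 0 , λ ()
          bound (x ∷ xs) with bound xs
          ... | N , below = suc x ⊔ N , λ where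
            (here refl) → m≤m⊔n (suc x) N
            (there n∈)  → ≤-trans (below n∈) (m≤n⊔m (suc x) N)

          -- On A N every layer met has index at least N, so only points in no
          -- layer can be sent into an exceptional row.
          N : ℕ
          N = proj₁ (bound exceptions)

          Section : ℕ → 𝒫 ℕ
          Section n k = to (n , k) ∈ B

          L : ℕ → List ℕ
          L n with lem {P = ∣ Section n ∣< m}
          ... | yes (xs , _) = xs
          ... | no _ = []

          L-short : ∀ n → length (L n) ≤ m
          L-short n with lem {P = ∣ Section n ∣< m}
          ... | yes (xs , short , _) = <⇒≤ short
          ... | no _ = z≤n

          L-cover : ∀ n {k} → k ∈ Section n → n ∈ₗ exceptions ⊎ k ∈ₗ L n
          L-cover n k∈ with lem {P = ∣ Section n ∣< m}
          ... | yes (_ , _ , cover) = inj₂ (cover k∈)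
          ... | no large = inj₁ (proj₂ (proj₂ B∈ED) large)

          some-selection : ∃ λ (g : ℕ → ℕ) → (λ k → k ∈ (A N ∩ H) × g (lev k) ≡ k) ∈ 𝒥 ⁺
          some-selection = ¬∀⇒∃¬ λ small → H∩A N (⊆-closed
            (λ {k} (k∈H , k∈A) → case L-cover (lev k) k∈H of λ where
              (inj₁ lev∈) → inj₂ (subst (_∈ₗ exceptions)
                 (lev-high k∈A (proj₂ (bound exceptions) lev∈)) lev∈)
              (inj₂ k∈L)  → inj₁ ((k∈A , k∈H) , k∈L))
            (∪-closed (selections-small lev (A N ∩ H) small m L L-short)
              (finite {A = _∈ₗ exceptions} (exceptions , id))))

          g : ℕ → ℕ
          g = proj₁ some-selection

          Y : 𝒫 ℕ
          Y k = k ∈ (A N ∩ H) × g (lev k) ≡ k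

          Y∈⁺ : Y ∈ 𝒥 ⁺
          Y∈⁺ = proj₂ some-selection

    -- A selective extension of 𝒥 is above 𝒥 by the identity and rules out a
    -- reduction of ED.  If 𝒥 has none, then no ideal 𝒥′ above it is selective, so
    -- for each of them some countable family does admit a reduction.
    extendable⇔ED-unreduced : (𝒢 : FunctionClass) → id ∈ 𝒢 → (𝒥 : Family 0ℓ ℕ) → IsIdeal 𝒥 →
      ExtendableToSelective 𝒥 ⇔ (¬ (ED ≼ω₁[ All-functions , 𝒢 ] 𝒥))
    extendable⇔ED-unreduced 𝒢 id∈𝒢 𝒥 ideal = mk⇔ forth back
      where
      forth : ExtendableToSelective 𝒥 → ¬ (ED ≼ω₁[ All-functions , 𝒢 ] 𝒥)
      forth (𝒥′ , selective , 𝒥⊆𝒥′) reduced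
        with reduced 𝒥′ (IsSelectiveIdeal.isIdeal selective) (id , id∈𝒢 , λ _ → 𝒥⊆𝒥′)
      ... | 𝒜 , countable , U∉ , ED≤ = selective⇒ED≰ selective 𝒜 countable U∉ ED≤
      back : ¬ (ED ≼ω₁[ All-functions , 𝒢 ] 𝒥) → ExtendableToSelective 𝒥
      back unreduced = ¬¬-elim λ ¬extendable → unreduced λ 𝒥′ ideal′ (f , _ , pull) →
        ¬¬-elim λ none → ¬extendable (selective-above⇒extendable 𝒥 ideal
          (ED≰⇒selective ideal′ λ 𝒜 countable U∉ ED≤ → none (𝒜 , countable , U∉ , ED≤))
          (f , _ , pull))

  -- Characteristic functions

  -- Sets with the same points have equal characteristic functions, whereas as
  -- predicates they need not be equal.  Choices made from characteristic
  -- functions therefore depend on the set alone.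

  χ : {X : Set} → 𝒫 X → X → Bool
  χ P x = does (lem {P = x ∈ P})

  ⟦_⟧ : {X : Set} → (X → Bool) → 𝒫 X
  ⟦ b ⟧ x = T (b x)

  χ-cong : {X : Set} {P Q : 𝒫 X} → P ≐ Q → χ P ≡ χ Q
  χ-cong (P⊆Q , Q⊆P) = ext λ x → does-⇔ (mk⇔ P⊆Q Q⊆P) lem lem

  χ-⟦⟧ : {X : Set} (b : X → Bool) → χ ⟦ b ⟧ ≡ b
  χ-⟦⟧ b = ext λ x → does-⇔ (mk⇔ id id) lem (T? (b x))

  ⟦χ⟧⊆ : {X : Set} (P : 𝒫 X) → ⟦ χ P ⟧ ⊆ P
  ⟦χ⟧⊆ P {x} t with lem {P = x ∈ P}
  ... | yes x∈P = x∈P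

  ⊆⟦χ⟧ : {X : Set} (P : 𝒫 X) → P ⊆ ⟦ χ P ⟧
  ⊆⟦χ⟧ P {x} x∈P with lem {P = x ∈ P}
  ... | yes _ = tt
  ... | no x∉P = x∉P x∈P

  -- Well-ordering a set

  module WellOrdering (X : Set) where
    -- The singleton of a chosen point outside b, or empty if b is everything.
    Fresh : (X → Bool) → 𝒫 X
    Fresh b x with lem {P = ∃ λ y → ¬ T (b y)}
    ... | yes (y , _) = y ≡ x
    ... | no _ = ⊥

    Fresh-unique : ∀ b {x y} → x ∈ Fresh b → y ∈ Fresh b → x ≡ y
    Fresh-unique b x∈ y∈ with lem {P = ∃ λ y → ¬ T (b y)}
    ... | yes _ = trans (sym x∈) y∈

    Fresh-outside : ∀ b {x} → x ∈ Fresh b → x ∉ ⟦ b ⟧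
    Fresh-outside b x∈ with lem {P = ∃ λ y → ¬ T (b y)}
    Fresh-outside b refl | yes (_ , y∉) = y∉

    Fresh-exists : ∀ b {x} → x ∉ ⟦ b ⟧ → ∃ (_∈ Fresh b)
    Fresh-exists b {x} x∉ with lem {P = ∃ λ y → ¬ T (b y)}
    ... | yes (y , _) = y , refl
    ... | no none = ⊥-elim (none (x , x∉))

    El : Code X → 𝒫 X
    El start    = ∅
    El (next s) = El s ∪ Fresh (χ (El s))
    El (⋃ f) x  = ∃ λ i → x ∈ El (f i)

    next-mono : ∀ s t → El s ≐ El t → El (next s) ⊆ El (next t)
    next-mono s t s≐t {x} = Sum.map (proj₁ s≐t) (subst (λ b → x ∈ Fresh b) (χ-cong s≐t))

    -- Linearity of the stages under inclusion is the Bourbaki-Witt argument: an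
    -- extreme stage is comparable with every stage, and every stage is extreme.
    Extreme : Code X → Set
    Extreme s = ∀ t → El t ⊆ El s → ¬ (El s ⊆ El t) → El (next t) ⊆ El s

    compare : ∀ s → Extreme s → ∀ t → El t ⊆ El s ⊎ El (next s) ⊆ El t
    compare s extreme start = inj₁ λ ()
    compare s extreme (next t) with compare s extreme t
    ... | inj₂ s⁺⊆t = inj₂ λ x∈ → inj₁ (s⁺⊆t x∈)
    ... | inj₁ t⊆s with lem {P = El s ⊆ El t}
    ...   | yes s⊆t = inj₂ (next-mono s t (s⊆t , t⊆s))
    ...   | no s⊈t = inj₁ (extreme t t⊆s s⊈t)
    compare s extreme (⋃ f) with lem {P = ∃ λ i → El (next s) ⊆ El (f i)}
    ... | yes (i , s⁺⊆) = inj₂ λ x∈ → i , s⁺⊆ x∈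
    ... | no none⊇ = inj₁ λ (i , x∈) →
          case compare s extreme (f i) of λ where
            (inj₁ fi⊆s) → fi⊆s x∈
            (inj₂ s⁺⊆)  → ⊥-elim (none⊇ (i , s⁺⊆))

    all-extreme : ∀ s → Extreme s
    all-extreme start t t⊆ ⊈t = ⊥-elim (⊈t λ ())
    all-extreme (next s) t t⊆s⁺ s⁺⊈t with compare s (all-extreme s) t
    ... | inj₂ s⁺⊆t = ⊥-elim (s⁺⊈t s⁺⊆t)
    ... | inj₁ t⊆s with lem {P = El s ⊆ El t}
    ...   | yes s⊆t = next-mono t s (t⊆s , s⊆t)
    ...   | no s⊈t = λ x∈ → inj₁ (all-extreme s t t⊆s s⊈t x∈)
    all-extreme (⋃ f) t t⊆ ⊈t with ¬∀⇒∃¬ {P = λ i → El (f i) ⊆ El t} (λ all → ⊈t λ (i , x∈) → all i x∈)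
    ... | i , fi⊈t with compare (f i) (all-extreme (f i)) t
    ...   | inj₁ t⊆fi = λ x∈ → i , all-extreme (f i) t t⊆fi fi⊈t x∈
    ...   | inj₂ fi⁺⊆t = ⊥-elim (fi⊈t λ x∈ → fi⁺⊆t (inj₁ x∈))

    linear : ∀ s t → El t ⊆ El s ⊎ El (next s) ⊆ El t
    linear s = compare s (all-extreme s)

    -- Order of appearance in the exhaustion.
    _≺_ : Rel X 0ℓ
    x ≺ y = ∃ λ s → x ∈ El s × y ∉ El s

    ≺-trans : Transitive _≺_
    ≺-trans (s , x∈s , y∉s) (t , y∈t , z∉t) with linear s t
    ... | inj₁ t⊆s  = ⊥-elim (y∉s (t⊆s y∈t))
    ... | inj₂ s⁺⊆t = t , s⁺⊆t (inj₁ x∈s) , z∉t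

    -- The union of all stages disjoint from Q is the largest such stage, so its
    -- successor, being strictly larger, meets Q in its one new point.
    least : ∀ (Q : 𝒫 X) {q} → q ∈ Q → ∃ λ s → El s ⊆ ∁ Q × ∃ λ x → x ∈ Q × x ∈ Fresh (χ (El s))
    least Q {q} q∈Q = s , s∥Q , ¬¬-elim λ missed → larger missed
      where
      stage : X → Code X
      stage z with lem {P = ∃ λ s → z ∈ El s × El s ⊆ ∁ Q}
      ... | yes (s , _) = s
      ... | no _ = start
      s : Code X
      s = ⋃ stage
      s∥Q : El s ⊆ ∁ Q
      s∥Q (z , x∈) with lem {P = ∃ λ s → z ∈ El s × El s ⊆ ∁ Q}
      ... | yes (_ , _ , avoids) = avoids x∈
      maximal : ∀ t → El t ⊆ ∁ Q → El t ⊆ El s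
      maximal t t∥Q {z} z∈ = z , z∈stage
        where
        z∈stage : z ∈ El (stage z)
        z∈stage with lem {P = ∃ λ s → z ∈ El s × El s ⊆ ∁ Q}
        ... | yes (_ , z∈s , _) = z∈s
        ... | no none = ⊥-elim (none (t , z∈ , t∥Q))
      larger : ¬ ¬ (∃ λ x → x ∈ Q × x ∈ Fresh (χ (El s)))
      larger missed with Fresh-exists (χ (El s)) (λ q∈s → s∥Q (⟦χ⟧⊆ (El s) q∈s) q∈Q)
      ... | z , fresh = Fresh-outside (χ (El s)) fresh (⊆⟦χ⟧ (El s) (maximal (next s)
              (λ { (inj₁ x∈s) → s∥Q x∈s ; (inj₂ x-fresh) x∈Q → missed (_ , x∈Q , x-fresh) })
              (inj₂ fresh)))

    ≺-connex : ∀ x y → x ≢ y → x ≺ y ⊎ y ≺ x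
    ≺-connex x y x≢y with least (λ z → x ≡ z ⊎ y ≡ z) (inj₁ refl)
    ... | s , avoids , _ , inj₁ refl , fresh = inj₁ (next s , inj₂ fresh , λ where
            (inj₁ y∈s) → avoids y∈s (inj₂ refl)
            (inj₂ y-fresh) → x≢y (Fresh-unique (χ (El s)) fresh y-fresh))
    ... | s , avoids , _ , inj₂ refl , fresh = inj₂ (next s , inj₂ fresh , λ where
            (inj₁ x∈s) → avoids x∈s (inj₁ refl)
            (inj₂ x-fresh) → x≢y (Fresh-unique (χ (El s)) x-fresh fresh))

    -- Whatever precedes the new point of a successor stage s⁺ already lies in s.
    El-accessible : ∀ s {x} → x ∈ El s → Acc _≺_ x
    El-accessible (⋃ f) (i , x∈) = El-accessible (f i) x∈
    El-accessible (next s) (inj₁ x∈s) = El-accessible s x∈s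
    El-accessible (next s) (inj₂ fresh) = acc λ (t , y∈t , x∉t) → case linear s t of λ where
      (inj₁ t⊆s)  → El-accessible s (t⊆s y∈t)
      (inj₂ s⁺⊆t) → ⊥-elim (x∉t (s⁺⊆t (inj₂ fresh)))

    ≺-wf : WellFounded _≺_
    ≺-wf x with least (x ≡_) refl
    ... | s , _ , _ , refl , fresh = El-accessible (next s) (inj₂ fresh)

    wellOrder : WellOrder X
    wellOrder = record
      { _≺_ = _≺_ ; ≺-wf = ≺-wf ; ≺-connex = ≺-connex
      ; ≺-trans = λ {x} {y} {z} → ≺-trans {x} {y} {z} }

  -- A schedule from the continuum hypothesis

  module Scheduling (φ : (ℕ × ℕ) ⤖ ℕ) (cantor-order : WellOrder Cantor) where
    open Reduction φ using (from; from-to)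
    open WellOrder cantor-order

    open Bijection φ using (to)

    -- The early points of Cantor space, as a family of subsets of ω to which CH
    -- applies.
    𝓔 : Family 0ℓ ℕ
    𝓔 A = Early (χ A)

    early-𝓔 : ∀ {x} → Early x → ⟦ x ⟧ ∈ 𝓔
    early-𝓔 {x} early = subst Early (sym (χ-⟦⟧ x)) early

    -- If the early points were enumerated, then by induction every point would be
    -- early: its predecessors, being early, are among those enumerated.
    𝓔-uncountable : ¬ Countable 𝓔
    𝓔-uncountable (e , covers) = Cantor-uncountable (χ∘e , λ {x} _ → early⇒listed x (all-early x))
      where
      χ∘e : ℕ → Cantor
      χ∘e n = χ (e n)
      early⇒listed : ∀ x → Early x → ∃ λ n → χ∘e n ≡ x
      early⇒listed x early with covers (early-𝓔 early)
      ... | n , x≐en = n , trans (sym (χ-cong x≐en)) (χ-⟦⟧ x)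
      all-early : ∀ x → Early x
      all-early = WF.All.wfRec ≺-wf 0ℓ Early λ x below → χ∘e , λ {y} y≺x → early⇒listed y (below y≺x)

    -- Each early point codes the subset of ω assigned to it by the bijection, and
    -- that subset, read through φ, codes the sequence of its rows.
    bijection⇒schedule : Bijection ∣ 𝓔 ∣ₛ (≐-setoid ℕ 0ℓ) → Schedule
    bijection⇒schedule β = record
      { Stage = Cantor ; wellOrder = cantor-order
      ; task = λ x n k → code x (to (n , k)) ; scheduled = scheduled }
      where
      code : Cantor → 𝒫 ℕ
      code x with lem {P = Early x}
      ... | yes early = Bijection.to β (⟦ x ⟧ , early-𝓔 early)
      ... | no _ = ∅
      code-early : ∀ x → Early x → ∃ λ early → code x ≡ Bijection.to β (⟦ x ⟧ , early-𝓔 early)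
      code-early x early with lem {P = Early x}
      ... | yes early′ = early′ , refl
      ... | no late = ⊥-elim (late early)
      code-onto : ∀ B → ∃ λ x → x ∈ Early × code x ≐ B
      code-onto B with Bijection.surjective β B
      ... | (A , A∈𝓔) , β≐ with code-early (χ A) A∈𝓔
      ...   | _ , code≡ = χ A , A∈𝓔 , subst (_≐ B) (sym code≡) (β≐ (⟦χ⟧⊆ A , ⊆⟦χ⟧ A))
      scheduled : ∀ (A : ℕ → 𝒫 ℕ) → ∃ λ x → x ∈ Early × (∀ n → (λ k → code x (to (n , k))) ≐ A n)
      scheduled A with code-onto (λ p → A (proj₁ (from p)) (proj₂ (from p)))
      ... | x , early , ⊆A , A⊆ = x , early , λ n →
              (λ {k} k∈ → subst (λ p → A (proj₁ p) (proj₂ p)) (from-to (n , k)) (⊆A k∈)) ,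
              (λ {k} k∈ → A⊆ (subst (λ p → A (proj₁ p) (proj₂ p)) (sym (from-to (n , k))) k∈))

    -- CH leaves the uncountable family of early points no size but that of the
    -- continuum.
    CH⇒schedule : CH → Schedule
    CH⇒schedule ch =
      [ (λ countable → ⊥-elim (𝓔-uncountable countable)) , bijection⇒schedule ]′ (ch 𝓔)

  -- Dual ideals of ultrafilters

  module Dual {𝒰 : Family 0ℓ ℕ} (ultrafilter : IsUltrafilter 𝒰) where
    open IsUltrafilter ultrafilter

    ∁∈⇒∈* : ∀ {A} → ∁ A ∈ 𝒰 → A ∈ (𝒰 *)
    ∁∈⇒∈* {A} ∁A∈ = ∁ A , ∁A∈ , (λ x∈A x∉A → x∉A x∈A) , ¬¬-elim

    ∈*⇒∁∈ : ∀ {A} → A ∈ (𝒰 *) → ∁ A ∈ 𝒰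
    ∈*⇒∁∈ (B , B∈ , A≐∁B) = ⊆-closed (λ x∈B x∈A → proj₁ A≐∁B x∈A x∈B) B∈

    *⁺⇒∈ : ∀ {A} → A ∈ (𝒰 *) ⁺ → A ∈ 𝒰
    *⁺⇒∈ {A} A∈⁺ = [ id , (λ ∁A∈ → ⊥-elim (A∈⁺ (∁∈⇒∈* ∁A∈))) ]′ (ultra A)

    ∈⇒*⁺ : ∀ {A} → A ∈ 𝒰 → A ∈ (𝒰 *) ⁺
    ∈⇒*⁺ A∈ A∈* = proper (⊆-closed (λ (x∈A , x∉A) → x∉A x∈A) (∩-closed A∈ (∈*⇒∁∈ A∈*)))

    dual-ideal : IsIdeal (𝒰 *)
    dual-ideal = record
      { ∪-closed = λ A∈* B∈* → ∁∈⇒∈* (⊆-closed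
          (λ (x∉A , x∉B) → [ x∉A , x∉B ]′) (∩-closed (∈*⇒∁∈ A∈*) (∈*⇒∁∈ B∈*)))
      ; ⊆-closed = λ A⊆B B∈* → ∁∈⇒∈* (⊆-closed (λ x∉B x∈A → x∉B (A⊆B x∈A)) (∈*⇒∁∈ B∈*))
      ; finite = λ {A} A-finite → ∁∈⇒∈* (cofinite (Finite-⊆ (∁ (∁ A)) A ¬¬-elim A-finite))
      ; proper = ∈⇒*⁺ (cofinite ([] , λ x∉U → ⊥-elim (x∉U tt)))
      }

  -- A selective ultrafilter from a schedule

  module Tower (schedule : Schedule) {𝒥 : Family 0ℓ ℕ} (selective : IsSelectiveIdeal 𝒥) where
    open Schedule schedule
    open Selective selective hiding (⊆-closed; proper)
    private module 𝒥 = IsIdeal isIdeal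

    Step : (x : Stage) → (∃ (_≺ x) → 𝒫 ℕ) → 𝒫 ℕ → Set
    Step x previous Y =
      Y ∈ 𝒥 ⁺ × (∀ p → Y ⊆* previous p) × (Decreasing (task x) → Settles Y (task x))

    -- The default value is taken only where no admissible set exists, which does
    -- not happen at early stages.  The construction is abstract so that only its
    -- defining properties are ever used.
    abstract
      step : (x : Stage) → (∃ (_≺ x) → 𝒫 ℕ) → 𝒫 ℕ
      step x previous with lem {P = ∃ (Step x previous)}
      ... | yes (Y , _) = Y
      ... | no _ = ∅

      step-correct : ∀ x previous → ∃ (Step x previous) → Step x previous (step x previous)
      step-correct x previous possible with lem {P = ∃ (Step x previous)}
      ... | yes (_ , Y-step) = Y-step
      ... | no none = ⊥-elim (none possible)

    recursive-step : ∀ x → (∀ {y} → y ≺ x → 𝒫 ℕ) → 𝒫 ℕ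
    recursive-step x previous = step x (λ (_ , y≺x) → previous y≺x)

    abstract
      tower : Stage → 𝒫 ℕ
      tower = WF.All.wfRec ≺-wf (lsuc 0ℓ) (λ _ → 𝒫 ℕ) recursive-step

    earlier : ∀ x → ∃ (_≺ x) → 𝒫 ℕ
    earlier x (y , _) = tower y

    abstract
      tower-unfold : ∀ x → tower x ≡ step x (earlier x)
      tower-unfold x = FixPoint.unfold-wfRec ≺-wf (λ _ → 𝒫 ℕ) recursive-step
        (λ x agree → cong (step x) (ext λ (_ , y≺x) → agree y≺x))

    Correct : 𝒫 Stage
    Correct x = Step x (earlier x) (tower x)

    early-≺ : ∀ {x y} → y ≺ x → Early x → Early y
    early-≺ y≺x (e , covers) = e , λ z≺y → covers (≺-trans z≺y y≺x)

    comparable : ∀ {x y} → Correct x → Correct y → tower x ⊆* tower y ⊎ tower y ⊆* tower x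
    comparable {x} {y} (_ , below-x , _) (_ , below-y , _) with lem {P = x ≡ y}
    ... | yes refl = inj₁ (⊆⇒⊆* (tower x) (tower x) id)
    ... | no x≢y = [ (λ x≺y → inj₂ (below-y (x , x≺y))) , (λ y≺x → inj₁ (below-x (y , y≺x))) ]′
                     (≺-connex x y x≢y)

    -- The earlier sets can be listed in a sequence, and they form a chain, so the
    -- listed sets have a positive pseudo-intersection.
    lower-bound : ∀ x → Early x → (∀ {y} → y ≺ x → Correct y) →
                  ∃ λ P → P ∈ 𝒥 ⁺ × (∀ {y} → y ≺ x → P ⊆* tower y)
    lower-bound x (e , covers) correct
      with pseudo-intersection Z (meet-chain Z Z-comparable Z∈⁺)
      where
      Z : ℕ → 𝒫 ℕ
      Z n with lem {P = e n ≺ x}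
      ... | yes _ = tower (e n)
      ... | no _ = U
      Z∈⁺ : ∀ n → Z n ∈ 𝒥 ⁺
      Z∈⁺ n with lem {P = e n ≺ x}
      ... | yes y≺x = proj₁ (correct y≺x)
      ... | no _ = 𝒥.proper
      Z-comparable : ∀ m n → Z m ⊆* Z n ⊎ Z n ⊆* Z m
      Z-comparable m n with lem {P = e m ≺ x} | lem {P = e n ≺ x}
      ... | yes m≺x | yes n≺x = comparable (correct m≺x) (correct n≺x)
      ... | no _ | yes _ = inj₂ (⊆⇒⊆* (tower (e n)) U _)
      ... | yes _ | no _ = inj₁ (⊆⇒⊆* (tower (e m)) U _)
      ... | no _ | no _ = inj₁ (⊆⇒⊆* {X = ℕ} U U _)
    ... | P , P∈⁺ , P⊆*Z = P , P∈⁺ , below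
      where
      below : ∀ {y} → y ≺ x → P ⊆* tower y
      below y≺x with covers y≺x
      ... | n , refl with P⊆*Z n
      ...   | P⊆* with lem {P = e n ≺ x}
      ...     | yes _ = P⊆*
      ...     | no ⊀ = ⊥-elim (⊀ y≺x)

    step-possible : ∀ x → Early x → (∀ {y} → y ≺ x → Correct y) →
                    ∃ (Step x (earlier x))
    step-possible x early correct with lower-bound x early correct | lem {P = Decreasing (task x)}
    ... | P , P∈⁺ , below | no ¬dec = P , P∈⁺ , (λ (_ , y≺x) → below y≺x) , λ dec → ⊥-elim (¬dec dec)
    ... | P , P∈⁺ , below | yes dec with settle (task x) dec P P∈⁺
    ...   | Y , Y∈⁺ , Y⊆P , settled = Y , Y∈⁺ ,
            (λ (y , y≺x) → ⊆*-trans Y P (tower y) (⊆⇒⊆* Y P Y⊆P) (below y≺x)) , λ _ → settled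

    abstract
      early⇒correct : ∀ x → Early x → Correct x
      early⇒correct = WF.All.wfRec ≺-wf 0ℓ (λ x → Early x → Correct x) λ x below early →
        subst (Step x (earlier x)) (sym (tower-unfold x))
          (step-correct x (earlier x)
            (step-possible x early λ y≺x → below y≺x (early-≺ y≺x early)))

    settled : ∀ A → Decreasing A → ∃ λ x → Early x × Settles (tower x) A
    settled A dec = settle-at (scheduled A)
      where
      settle-at : (∃ λ x → Early x × (∀ n → task x n ≐ A n)) → ∃ λ x → Early x × Settles (tower x) A
      settle-at (x , early , task≐A) = x , early ,
        Settles-≐ (tower x) (task x) A task≐A (proj₂ (proj₂ (early⇒correct x early)) task-decreasing)
        where
        task-decreasing : Decreasing (task x)
        task-decreasing n k∈ = proj₂ (task≐A n) (dec n (proj₁ (task≐A (suc n)) k∈))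

    𝒰 : Family 0ℓ ℕ
    𝒰 A = ∃ λ x → Early x × tower x ⊆* A

    tower∈𝒰 : ∀ {x A} → Early x → tower x ⊆ A → A ∈ 𝒰
    tower∈𝒰 {x} {A} early x⊆A = x , early , ⊆⇒⊆* (tower x) A x⊆A

    Decides : Stage → 𝒫 ℕ → Set
    Decides x B = tower x ⊆ ∁ B ⊎ tower x ⊆ B

    settles⇒decides : ∀ x B → Settles (tower x) (λ _ → B) → Decides x B
    settles⇒decides x B (inj₁ (_ , x∥B)) = inj₁ x∥B
    settles⇒decides x B (inj₂ (x⊆B , _)) = inj₂ x⊆B

    -- Settling a constant sequence.
    decided : ∀ B → ∃ λ x → Early x × Decides x B
    decided B = map₂ (λ {x} → map₂ (settles⇒decides x B)) (settled (λ _ → B) (λ _ → id))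

    isUltrafilter : IsUltrafilter 𝒰
    isUltrafilter = record
      { ∩-closed = ∩-closed
      ; ⊆-closed = λ {A} {B} A⊆B (x , early , x⊆*A) →
          x , early , ⊆*-trans (tower x) A B x⊆*A (⊆⇒⊆* A B A⊆B)
      ; cofinite = λ {A} ∁A-finite → case decided U of λ where
          (x , early , _) → x , early , Finite-⊆ (tower x ∖ A) (∁ A) proj₂ ∁A-finite
      ; proper = λ (x , early , x⊆*∅) → proj₁ (early⇒correct x early)
          (𝒥.finite (Finite-⊆ (tower x) (tower x ∖ ∅) (λ k∈ → k∈ , λ ()) x⊆*∅))
      ; ultra = λ A → case decided A of λ where
          (x , early , inj₁ x⊆∁A) → inj₂ (tower∈𝒰 early x⊆∁A)
          (x , early , inj₂ x⊆A)  → inj₁ (tower∈𝒰 early x⊆A)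
      }
      where
      ∩-closed : ∀ {A B} → A ∈ 𝒰 → B ∈ 𝒰 → (A ∩ B) ∈ 𝒰
      ∩-closed {A} {B} (x , early-x , x⊆*A) (y , early-y , y⊆*B)
        with comparable (early⇒correct x early-x) (early⇒correct y early-y)
      ... | inj₁ x⊆*y = x , early-x ,
              ⊆*-∩ (tower x) A B x⊆*A (⊆*-trans (tower x) (tower y) B x⊆*y y⊆*B)
      ... | inj₂ y⊆*x = y , early-y ,
              ⊆*-∩ (tower y) A B (⊆*-trans (tower y) (tower x) A y⊆*x x⊆*A) y⊆*B

    open IsUltrafilter isUltrafilter using (∩-closed; ⊆-closed; proper)
    open Dual isUltrafilter

    -- A set of the tower is positive, so it cannot lie inside a member of 𝒥.
    𝒥⊆𝒰* : 𝒥 ⊆ (𝒰 *)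
    𝒥⊆𝒰* {B} B∈𝒥 with decided B
    ... | x , early , inj₁ x⊆∁B = ∁∈⇒∈* (tower∈𝒰 early x⊆∁B)
    ... | x , early , inj₂ x⊆B  = ⊥-elim (proj₁ (early⇒correct x early) (𝒥.⊆-closed x⊆B B∈𝒥))

    -- The set settling A is in the ultrafilter, as is each A n; they cannot be
    -- disjoint, so that set is a transversal.
    dual-selective : IsSelectiveIdeal (𝒰 *)
    dual-selective = record { isIdeal = dual-ideal ; selector = dual-selector }
      where
      dual-selector : (A : ℕ → 𝒫 ℕ) → (∀ n → A n ∈ (𝒰 *) ⁺) → Decreasing A →
                      ∃ λ B → B ∈ (𝒰 *) ⁺ × Transversal B A
      dual-selector A positive dec with settled A dec
      ... | x , early , inj₁ (n , x∥An) = ⊥-elim (proper (⊆-closed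
              (λ (k∈x , k∈An) → x∥An k∈x k∈An) (∩-closed (tower∈𝒰 early id) (*⁺⇒∈ (positive n)))))
      ... | x , early , inj₂ transversal =
              tower x , ∈⇒*⁺ (tower∈𝒰 early id) , transversal

  -- From left to right the identity is the reduction to the dual of the
  -- ultrafilter built above the selective extension.  From right to left the
  -- dual is a selective ideal above 𝒥.
  selective-ultrafilter⇔ : Schedule → (𝒢 : FunctionClass) → id ∈ 𝒢 → (𝒥 : Family 0ℓ ℕ) → IsIdeal 𝒥 →
    ExtendableToSelective 𝒥 ⇔
      (∃ λ (𝒰 : Family 0ℓ ℕ) → IsSelectiveUltrafilter 𝒰 × (¬ (¬ (𝒥 ≤[ 𝒢 ] (𝒰 *)))))
  selective-ultrafilter⇔ schedule 𝒢 id∈𝒢 𝒥 ideal = mk⇔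
    (λ (_ , selective , 𝒥⊆𝒥′) →
      let open Tower schedule selective in
      𝒰 , (isUltrafilter , dual-selective) , λ none → none (id , id∈𝒢 , λ _ B∈𝒥 → 𝒥⊆𝒰* (𝒥⊆𝒥′ B∈𝒥)))
    (λ (_ , (_ , selective) , ¬¬≤) → case ¬¬-elim ¬¬≤ of λ where
      (f , _ , pull) → selective-above⇒extendable 𝒥 ideal selective (f , _ , pull))

theorem9p3 :
  -- classical foundations
  (∀ {ℓ} → ExcludedMiddle ℓ) →
  (∀ {a b} → Extensionality a b) →
  -- the fixed identification of ω × ω with ω
  (φ : (ℕ × ℕ) ⤖ ℕ) →
  (𝒥 : Family 0ℓ ℕ) → IsIdeal 𝒥 →
  -- (1)
  ( (ExtendableToSelective 𝒥 ⇔ (¬ (transport φ 𝓔𝓓 ≼ω₁[ All-functions , 1-1 ] 𝒥)))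
  × (ExtendableToSelective 𝒥 ⇔ (¬ (transport φ 𝓔𝓓 ≼ω₁[ All-functions , Fin-1 ] 𝒥)))
  × (ExtendableToSelective 𝒥 ⇔ (¬ (transport φ 𝓔𝓓 ≼ω₁[ All-functions , All-functions ] 𝒥)))
  )
  ×
  -- (2)
  ( CH →
    (ExtendableToSelective 𝒥 ⇔ (∃ λ (𝒰 : Family 0ℓ ℕ) → IsSelectiveUltrafilter 𝒰 × (¬ ((𝒥 -Point) 𝒰))))
  × (ExtendableToSelective 𝒥 ⇔ (∃ λ (𝒰 : Family 0ℓ ℕ) → IsSelectiveUltrafilter 𝒰 × (¬ ((𝒥 -WeakUltrafilter) 𝒰))))
  × (ExtendableToSelective 𝒥 ⇔ (∃ λ (𝒰 : Family 0ℓ ℕ) → IsSelectiveUltrafilter 𝒰 × (¬ ((𝒥 -Ultrafilter) 𝒰))))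
  )
theorem9p3 lem ext φ 𝒥 ideal =
    ( extendable⇔ED-unreduced 1-1 id 𝒥 ideal
    , extendable⇔ED-unreduced Fin-1 id∈Fin-1 𝒥 ideal
    , extendable⇔ED-unreduced All-functions tt 𝒥 ideal )
  , λ ch →
      selective-ultrafilter⇔ (schedule ch) 1-1 id 𝒥 ideal
    , selective-ultrafilter⇔ (schedule ch) Fin-1 id∈Fin-1 𝒥 ideal
    , selective-ultrafilter⇔ (schedule ch) All-functions tt 𝒥 ideal
  where
  open Classical lem ext
  open Reduction φ
  schedule : CH → Schedule
  schedule = Scheduling.CH⇒schedule φ (WellOrdering.wellOrder Cantor)
  id∈Fin-1 : id ∈ Fin-1
  id∈Fin-1 n = (n ∷ []) , here
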